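{- Let $k,m$ be positive integers with $m\ge 5$ and let $b\in\{0,1,2,\ldots\}$. If $b$ is even, then $$S_{k\varphi(3^m)+b}-(1-(-3)^b)S_b\equiv 3^{m-2}k(-495+1350b+567b^2-162b^3+972b^4-729b^5)\pmod{3^{m+5}}.$$ If $b$ is odd, then $$S_{k\varphi(3^m)+b}-(1-(-3)^b)S_b\equiv 3^{m-2}k(1422+1242b-891b^2-81b^3+243b^4+729b^5)\pmod{3^{m+5}}.$$
   Context: The integer sequence $\{S_n\}_{n\ge0}$ is defined by $S_0=1$ and $S_n=1-\sum_{j=0}^{n-1}\binom{n}{j}2^{2n-2j-1}S_j$ for $n\ge 1$. $\varphi$ denotes Euler's totient function. -}

module Defs where

open import Data.Fin.Base using (Fin; toℕ)
open import Data.Fin.Properties using (toℕ<n)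
open import Data.Integer.Base using (ℤ; +_; _+_; _-_; _*_; _^_)
open import Data.Integer.Divisibility.Signed using (_∣_)
open import Data.Integer.Properties using (+-0-commutativeMonoid)
open import Data.List.Base using (length; filter; map; upTo)
open import Data.Nat.Base as ℕ using (ℕ; zero; suc; _∸_)
open import Data.Nat.Combinatorics using (_C_)
open import Data.Nat.Coprimality using (coprime?)
open import Data.Nat.Induction using (<-Rec; <-rec; <-wellFounded)
open import Induction.WellFounded using (module FixPoint)
open import Relation.Binary.PropositionalEquality using (_≡_; refl; cong)

open import Algebra.Properties.CommutativeMonoid.Sum +-0-commutativeMonoid
  using (sum-syntax; sum-cong-≗)

-- Since j < n in every use, the truncated exponent is the true 2n − 2j − 1.
coeff : ℕ → ℕ → ℤ
coeff n j = + (n C j) * (+ 2) ^ (2 ℕ.* n ∸ 2 ℕ.* j ∸ 1)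

private
  step : ∀ n → <-Rec (λ _ → ℤ) n → ℤ
  step zero      _   = + 1
  step n@(suc _) rec = + 1 - ∑[ j < n ] (coeff n (toℕ j) * rec (toℕ<n j))

  step-ext : ∀ n {f g : <-Rec (λ _ → ℤ) n} →
             (∀ {j} (j<n : j ℕ.< n) → f j<n ≡ g j<n) → step n f ≡ step n g
  step-ext zero      _   = refl
  step-ext n@(suc _) f≗g =
    cong (+ 1 -_)
      (sum-cong-≗ {n} λ j → cong (coeff n (toℕ j) *_) (f≗g (toℕ<n j)))

S : ℕ → ℤ
S = <-rec (λ _ → ℤ) step

S-zero : S 0 ≡ + 1
S-zero = refl

S-suc : ∀ m → let n = suc m in
        S n ≡ + 1 - ∑[ j < n ] (coeff n (toℕ j) * S (toℕ j))
S-suc m =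
  FixPoint.unfold-wfRec <-wellFounded (λ _ → ℤ) step step-ext {suc m}

φ : ℕ → ℕ
φ n = length (filter (λ i → coprime? i n) (map suc (upTo n)))

infix 4 _≡_[mod_]

_≡_[mod_] : ℤ → ℤ → ℤ → Set
x ≡ y [mod n ] = n ∣ x - y

{-# OPTIONS --safe #-}
module Submission where

-- S n = 4ⁿ Eₙ(1/4), so modulo an odd N the number S n agrees with the alternating
-- power sum Σ_{r<N} (−1)^r (4r+1)ⁿ: that sum satisfies the defining recurrence of S
-- modulo N, since consecutive terms telescope to 1 + (4N+1)ⁿ ≡ 2.  For N a power of 3, the
-- terms with 3 ∣ 4r+1 contribute (−3)ⁿ S n, and (1 − (−3)ⁿ) S n becomes a sum over
-- the 4r+1 prime to 3.  For such a,
--   a^{kφ(3^m)} − 1 ≡ k 3^{m−5} (a^162 − 1)  (mod 3^{m+5}),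
-- so the claim reduces to a congruence modulo 3^10 for the sum of ±a^b (a^162 − 1).
-- Its sixth difference in b with step 2 vanishes modulo 3^10, as does that of a
-- quintic polynomial, so six values of b of each parity decide it.

open import Defs
open import Data.Fin.Base as Fin using (Fin; toℕ; inject₁; fromℕ; fromℕ<)
open import Data.Fin.Properties using (all?; toℕ-fromℕ; toℕ-fromℕ<; toℕ-inject₁; toℕ<n)
open import Data.Integer.Base using (ℤ; +_; -_; _+_; _-_; _*_; _^_)
open import Data.Integer.Divisibility.Signed as ℤ∣ using (divides) renaming (_∣_ to _∣ℤ_)
open import Data.Integer.Properties as ℤₚ using (+-*-semiring; +-*-commutativeSemiring)
open import Data.Integer.Tactic.RingSolver using (solve-∀)
open import Data.List.Base using (_∷_; length; filter; map; upTo; applyUpTo)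
open import Data.List.Properties using (filter-accept; filter-reject; filter-≐; map-upTo)
open import Data.Nat.Base as ℕ using (ℕ; zero; suc; _≤_; _<_; _∸_; s≤s; z≤n)
open import Data.Nat.Combinatorics using (_C_; nCn≡1)
open import Data.Nat.Coprimality using (Coprime; coprime?; coprime-divisor)
open import Data.Nat.Divisibility as ℕ∣ using (_∣_; _∤_; _∣?_)
open import Data.Nat.Induction using (<-rec)
open import Data.Nat.Primality using (Prime; prime?; prime⇒irreducible)
import Data.Nat.Properties as ℕₚ
open import Data.Product.Base using (∃; _,_; _×_)
open import Data.Sum.Base using (_⊎_; inj₁; inj₂)
open import Function.Base using (_∘_)
open import Relation.Binary.PropositionalEquality
open import Relation.Nullary using (¬?; contradiction)
open import Relation.Nullary.Decidable using (toWitness)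

open import Algebra.Properties.CommutativeSemiring.Binomial +-*-commutativeSemiring
  using (theorem; binomialTerm)
import Algebra.Properties.Semiring.Exp +-*-semiring as Exp
import Algebra.Properties.Semiring.Mult +-*-semiring as Mult
open import Algebra.Properties.Semiring.Sum +-*-semiring
  using (sum; sum-syntax; sum-cong-≗; sum-init-last; *-distribˡ-sum; ∑-distrib-+)

-- The recurrence for S

^-semiring : ∀ x n → x Exp.^ n ≡ x ^ n
^-semiring x zero    = refl
^-semiring x (suc n) = cong (x *_) (^-semiring x n)

×-as-* : ∀ n x → n Mult.× x ≡ + n * x
×-as-* zero    x = sym (ℤₚ.*-zeroˡ x)
×-as-* (suc n) x =
  trans (cong (λ y → x + y) (×-as-* n x)) (sym (ℤₚ.suc-* (+ n) x))

-- Because j < n the exponent 2(n - j) is positive, so one factor 2 can be split off; what remains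
-- is the power of 2 inside `coeff`.
4^≡2*2^ : ∀ {n j} → j < n → (+ 4) ^ (n ∸ j) ≡ + 2 * (+ 2) ^ (2 ℕ.* n ∸ 2 ℕ.* j ∸ 1)
4^≡2*2^ {n} {j} j<n
  rewrite sym (ℕₚ.*-distribˡ-∸ 2 n j)
  with n ∸ j | ℕₚ.m<n⇒0<n∸m j<n
... | suc e | _ = ℤₚ.^-*-assoc (+ 2) 2 (suc e)

-- The binomial theorem with its top term x^n set apart; every other term carries a positive power
-- of 4 and so is twice a term with weight `coeff`. This ties the recurrence of S to the shift x ↦ x
-- + 4.
binomial-coeff : ∀ x n →
  (x + + 4) ^ n ≡ x ^ n + + 2 * ∑[ j < n ] (coeff n (toℕ j) * x ^ toℕ j)
binomial-coeff x n = begin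
  (x + + 4) ^ n                                   ≡⟨ ^-semiring (x + + 4) n ⟨
  (x + + 4) Exp.^ n                               ≡⟨ theorem n x (+ 4) ⟩
  sum (binomialTerm x (+ 4) n)                    ≡⟨ sum-init-last (binomialTerm x (+ 4) n) ⟩
  sum (binomialTerm x (+ 4) n ∘ inject₁) + binomialTerm x (+ 4) n (fromℕ n)
                                                  ≡⟨ cong₂ _+_ (sum-cong-≗ low) top ⟩
  ∑[ j < n ] (+ 2 * (coeff n (toℕ j) * x ^ toℕ j)) + x ^ n
                                                  ≡⟨ cong (_+ x ^ n) (*-distribˡ-sum {n} (+ 2)
                                                       (λ j → coeff n (toℕ j) * x ^ toℕ j)) ⟨
  + 2 * ∑[ j < n ] (coeff n (toℕ j) * x ^ toℕ j) + x ^ n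
                                                  ≡⟨ ℤₚ.+-comm _ (x ^ n) ⟩
  x ^ n + + 2 * ∑[ j < n ] (coeff n (toℕ j) * x ^ toℕ j) ∎
  where
  open ≡-Reasoning

  term : ∀ k → binomialTerm x (+ 4) n k ≡ + (n C toℕ k) * (x ^ toℕ k * (+ 4) ^ (n ∸ toℕ k))
  term k = trans (×-as-* (n C toℕ k) _)
    (cong (+ (n C toℕ k) *_) (cong₂ _*_ (^-semiring x (toℕ k)) (^-semiring (+ 4) (n ∸ toℕ k))))

  swap : ∀ c y z → c * (y * (+ 2 * z)) ≡ + 2 * (c * z * y)
  swap = solve-∀

  low : ∀ j → binomialTerm x (+ 4) n (inject₁ j) ≡ + 2 * (coeff n (toℕ j) * x ^ toℕ j)
  low j = begin
    binomialTerm x (+ 4) n (inject₁ j)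
      ≡⟨ term (inject₁ j) ⟩
    + (n C toℕ (inject₁ j)) * (x ^ toℕ (inject₁ j) * (+ 4) ^ (n ∸ toℕ (inject₁ j)))
      ≡⟨ cong (λ i → + (n C i) * (x ^ i * (+ 4) ^ (n ∸ i))) (toℕ-inject₁ j) ⟩
    + (n C toℕ j) * (x ^ toℕ j * (+ 4) ^ (n ∸ toℕ j))
      ≡⟨ cong (λ z → + (n C toℕ j) * (x ^ toℕ j * z)) (4^≡2*2^ (toℕ<n j)) ⟩
    + (n C toℕ j) * (x ^ toℕ j * (+ 2 * (+ 2) ^ (2 ℕ.* n ∸ 2 ℕ.* toℕ j ∸ 1)))
      ≡⟨ swap (+ (n C toℕ j)) (x ^ toℕ j) _ ⟩
    + 2 * (coeff n (toℕ j) * x ^ toℕ j) ∎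

  unit : ∀ y → + 1 * (y * + 1) ≡ y
  unit = solve-∀

  top : binomialTerm x (+ 4) n (fromℕ n) ≡ x ^ n
  top rewrite term (fromℕ n) | toℕ-fromℕ n | nCn≡1 n | ℕₚ.n∸n≡0 n = unit (x ^ n)

S-rec : ∀ n → S n ≡ + 1 - ∑[ j < n ] (coeff n (toℕ j) * S (toℕ j))
S-rec zero    = refl
S-rec (suc m) = S-suc m

∣-sum : ∀ {d n} (f : Fin n → ℤ) → (∀ j → d ∣ℤ f j) → d ∣ℤ sum f
∣-sum {n = zero}  f d∣f = divides (+ 0) refl
∣-sum {n = suc n} f d∣f = ℤ∣.∣m∣n⇒∣m+n (d∣f Fin.zero) (∣-sum (f ∘ Fin.suc) (d∣f ∘ Fin.suc))

-- Strong induction: S n - T n is, up to sign, the `coeff`-weighted sum of the earlier errors plus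
-- the amount by which T misses the recurrence, and d divides both.
S-unique-mod : ∀ d (T : ℕ → ℤ) →
  (∀ n → T n ≡ + 1 - ∑[ j < n ] (coeff n (toℕ j) * T (toℕ j)) [mod d ]) →
  ∀ n → S n ≡ T n [mod d ]
S-unique-mod d T T-rec = <-rec (λ n → d ∣ℤ S n - T n) λ n IH →
  let c  = λ (j : Fin n) → coeff n (toℕ j)
      s  = λ (j : Fin n) → S (toℕ j)
      t  = λ (j : Fin n) → T (toℕ j)
      eq : sum (λ j → c j * s j) ≡ sum (λ j → c j * t j) + sum (λ j → c j * (s j - t j))
      eq = trans (sum-cong-≗ (λ j → split (c j) (s j) (t j)))
                 (∑-distrib-+ (λ j → c j * t j) (λ j → c j * (s j - t j)))
  in subst (d ∣ℤ_)
       (sym (trans (cong (_- T n) (trans (S-rec n) (cong (λ z → + 1 - z) eq)))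
                   (rearrange (sum (λ j → c j * t j)) (sum (λ j → c j * (s j - t j))) (T n))))
       (ℤ∣.∣m⇒∣-m (ℤ∣.∣m∣n⇒∣m+n
         (∣-sum (λ j → c j * (s j - t j)) (λ j → ℤ∣.∣n⇒∣m*n (c j) (IH (toℕ<n j))))
         (T-rec n)))
  where
  split : ∀ c s t → c * s ≡ c * t + c * (s - t)
  split = solve-∀
  rearrange : ∀ t δ τ → + 1 - (t + δ) - τ ≡ - (δ + (τ - (+ 1 - t)))
  rearrange = solve-∀

-- Alternating sums

-- Subtracting the tail builds in the sign (-1)^s, so no power of -1 has to be carried.
altΣ : ℕ → (ℕ → ℤ) → ℤ
altΣ zero    f = + 0
altΣ (suc N) f = f 0 - altΣ N (f ∘ suc)

altΣ-cong : ∀ N {f g} → (∀ s → f s ≡ g s) → altΣ N f ≡ altΣ N g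
altΣ-cong zero    f≗g = refl
altΣ-cong (suc N) f≗g = cong₂ _-_ (f≗g 0) (altΣ-cong N (f≗g ∘ suc))

altΣ-+ : ∀ N f g → altΣ N (λ s → f s + g s) ≡ altΣ N f + altΣ N g
altΣ-+ zero    f g = refl
altΣ-+ (suc N) f g =
  trans (cong (λ z → f 0 + g 0 - z) (altΣ-+ N (f ∘ suc) (g ∘ suc)))
        (rearrange (f 0) (g 0) (altΣ N (f ∘ suc)) (altΣ N (g ∘ suc)))
  where
  rearrange : ∀ a b c d → a + b - (c + d) ≡ a - c + (b - d)
  rearrange = solve-∀

altΣ-* : ∀ N c f → altΣ N (λ s → c * f s) ≡ c * altΣ N f
altΣ-* zero    c f = sym (ℤₚ.*-zeroʳ c)
altΣ-* (suc N) c f =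
  trans (cong (λ z → c * f 0 - z) (altΣ-* N c (f ∘ suc)))
        (factor c (f 0) (altΣ N (f ∘ suc)))
  where
  factor : ∀ c a b → c * a - c * b ≡ c * (a - b)
  factor = solve-∀

altΣ-minus : ∀ N f g → altΣ N (λ s → f s - g s) ≡ altΣ N f - altΣ N g
altΣ-minus zero    f g = refl
altΣ-minus (suc N) f g =
  trans (cong (λ z → f 0 - g 0 - z) (altΣ-minus N (f ∘ suc) (g ∘ suc)))
        (rearrange (f 0) (g 0) (altΣ N (f ∘ suc)) (altΣ N (g ∘ suc)))
  where
  rearrange : ∀ a b c d → a - b - (c - d) ≡ a - c - (b - d)
  rearrange = solve-∀

altΣ-sum : ∀ N {n} (c : Fin n → ℤ) (f : Fin n → ℕ → ℤ) →
  altΣ N (λ s → sum (λ j → c j * f j s)) ≡ sum (λ j → c j * altΣ N (f j))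
altΣ-sum N {zero}  c f = zeros N
  where
  zeros : ∀ N → altΣ N (λ _ → + 0) ≡ + 0
  zeros zero    = refl
  zeros (suc N) = cong (λ z → + 0 - z) (zeros N)
altΣ-sum N {suc n} c f =
  trans (altΣ-+ N (λ s → c Fin.zero * f Fin.zero s) _)
        (cong₂ _+_ (altΣ-* N (c Fin.zero) (f Fin.zero))
                   (altΣ-sum N (c ∘ Fin.suc) (f ∘ Fin.suc)))

altΣ-∣ : ∀ {d} N {f} → (∀ s → d ∣ℤ f s) → d ∣ℤ altΣ N f
altΣ-∣ zero    d∣f = divides (+ 0) refl
altΣ-∣ (suc N) d∣f = ℤ∣.∣m∣n⇒∣m-n (d∣f 0) (altΣ-∣ N (d∣f ∘ suc))

-- Inner terms meet their neighbours with opposite sign, and odd N gives f N the sign +. Writing odd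
-- numbers as 1 + 2e lets the induction remove two terms at a time, which restores the signs.
altΣ-telescope : ∀ e f → let N = 1 ℕ.+ e ℕ.* 2 in
  altΣ N f + altΣ N (f ∘ suc) ≡ f 0 + f N
altΣ-telescope zero    f = rearrange (f 0) (f 1)
  where
  rearrange : ∀ a b → a - + 0 + (b - + 0) ≡ a + b
  rearrange = solve-∀
altΣ-telescope (suc e) f =
  trans (rearrange (f 0) (f 1) (f 2) (altΣ N g) (altΣ N (g ∘ suc)))
    (trans (cong (λ z → f 0 - f 2 + z) (altΣ-telescope e g)) (cancel (f 0) (f 2) _))
  where
  N = 1 ℕ.+ e ℕ.* 2
  g = f ∘ suc ∘ suc
  rearrange : ∀ a b c x y → a - (b - x) + (b - (c - y)) ≡ a - c + (x + y)
  rearrange = solve-∀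
  cancel : ∀ a c x → a - c + (c + x) ≡ a + x
  cancel = solve-∀

altΣ-+-odd : ∀ e N f → let p = 1 ℕ.+ e ℕ.* 2 in
  altΣ (p ℕ.+ N) f ≡ altΣ p f - altΣ N (λ s → f (p ℕ.+ s))
altΣ-+-odd zero    N f = cong (λ z → z - altΣ N (f ∘ suc)) (sym (ℤₚ.+-identityʳ (f 0)))
altΣ-+-odd (suc e) N f =
  trans (cong (λ z → f 0 - (f 1 - z)) (altΣ-+-odd e N (f ∘ suc ∘ suc)))
        (rearrange (f 0) (f 1) (altΣ (1 ℕ.+ e ℕ.* 2) (f ∘ suc ∘ suc)) _)
  where
  rearrange : ∀ a b x y → a - (b - (x - y)) ≡ a - (b - x) - y
  rearrange = solve-∀

-- Blocks of odd length p enter with alternating signs and are congruent to each other, so an odd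
-- number of them cancels in pairs down to one.
altΣ-periodic : ∀ {d} e t f → let p = 1 ℕ.+ e ℕ.* 2 in
  (∀ s → f (p ℕ.+ s) ≡ f s [mod d ]) →
  altΣ ((1 ℕ.+ t ℕ.* 2) ℕ.* p) f ≡ altΣ p f [mod d ]
altΣ-periodic {d} e zero f per =
  subst (λ N → altΣ N f ≡ altΣ p f [mod d ]) (sym (ℕₚ.*-identityˡ p))
    (divides (+ 0) (ℤₚ.+-inverseʳ (altΣ p f)))
  where p = 1 ℕ.+ e ℕ.* 2
altΣ-periodic {d} e (suc t) f per =
  subst (d ∣ℤ_) (sym eq)
    (ℤ∣.∣m∣n⇒∣m-n (altΣ-periodic e t f per)
       (ℤ∣.∣m∣n⇒∣m-n (subst (d ∣ℤ_) (altΣ-minus p (λ s → f (p ℕ.+ s)) f) (altΣ-∣ p per))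
                      (subst (d ∣ℤ_) (altΣ-minus N (λ s → f (p ℕ.+ (p ℕ.+ s))) f) (altΣ-∣ N per₂))))
  where
  p = 1 ℕ.+ e ℕ.* 2
  N = (1 ℕ.+ t ℕ.* 2) ℕ.* p
  per₂ : ∀ s → f (p ℕ.+ (p ℕ.+ s)) ≡ f s [mod d ]
  per₂ s = subst (d ∣ℤ_) (glue (f (p ℕ.+ (p ℕ.+ s))) (f (p ℕ.+ s)) (f s))
             (ℤ∣.∣m∣n⇒∣m+n (per (p ℕ.+ s)) (per s))
    where
    glue : ∀ x y z → x - y + (y - z) ≡ x - z
    glue = solve-∀
  rearrange : ∀ x y z w → x - (y - z) - x ≡ w - x - (y - x - (z - w))
  rearrange = solve-∀
  eq : altΣ (p ℕ.+ (p ℕ.+ N)) f - altΣ p f ≡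
       altΣ N f - altΣ p f - (altΣ p (λ s → f (p ℕ.+ s)) - altΣ p f
         - (altΣ N (λ s → f (p ℕ.+ (p ℕ.+ s))) - altΣ N f))
  eq = trans
    (cong (_- altΣ p f)
      (trans (altΣ-+-odd e (p ℕ.+ N) f)
             (cong (λ z → altΣ p f - z) (altΣ-+-odd e N (λ s → f (p ℕ.+ s))))))
    (rearrange (altΣ p f) (altΣ p (λ s → f (p ℕ.+ s))) _ (altΣ N f))

-- Since 3 is odd, (-1)^(3s) = (-1)^s, so the blocks of three alternate again.
altΣ-*3 : ∀ N f →
  altΣ (N ℕ.* 3) f ≡ altΣ N (λ s → f (s ℕ.* 3) - f (1 ℕ.+ s ℕ.* 3) + f (2 ℕ.+ s ℕ.* 3))
altΣ-*3 zero    f = refl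
altΣ-*3 (suc N) f =
  trans (cong (λ z → f 0 - (f 1 - (f 2 - z))) (altΣ-*3 N (λ s → f (3 ℕ.+ s))))
        (rearrange (f 0) (f 1) (f 2) _)
  where
  rearrange : ∀ a b c x → a - (b - (c - x)) ≡ a - b + c - x
  rearrange = solve-∀

-- For N = 1 + 2e, the integer 2 is invertible modulo N by x = Nx - e(2x).
∣2*⇒∣ : ∀ e x → let N = + (1 ℕ.+ e ℕ.* 2) in N ∣ℤ + 2 * x → N ∣ℤ x
∣2*⇒∣ e x N∣2x = subst (N ∣ℤ_) eq (ℤ∣.∣m∣n⇒∣m-n (ℤ∣.∣m⇒∣m*n x ℤ∣.∣-refl) (ℤ∣.∣n⇒∣m*n (+ e) N∣2x))
  where
  N = + (1 ℕ.+ e ℕ.* 2)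
  ring : ∀ E x → (+ 1 + E * + 2) * x - E * (+ 2 * x) ≡ x
  ring = solve-∀
  eq : N * x - + e * (+ 2 * x) ≡ x
  eq = trans (cong (λ z → z * x - + e * (+ 2 * x)) (cong (λ z → + 1 + z) (ℤₚ.pos-* e 2))) (ring (+ e) x)

-- S modulo an odd number as an alternating power sum

^-cong-mod : ∀ {d x y} n → x ≡ y [mod d ] → x ^ n ≡ y ^ n [mod d ]
^-cong-mod         zero    x≡y = divides (+ 0) refl
^-cong-mod {d} {x} {y} (suc n) x≡y =
  subst (d ∣ℤ_) (split x y (x ^ n) (y ^ n))
    (ℤ∣.∣m∣n⇒∣m+n (ℤ∣.∣n⇒∣m*n x (^-cong-mod {x = x} {y} n x≡y)) (ℤ∣.∣m⇒∣m*n (y ^ n) x≡y))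
  where
  split : ∀ x y X Y → x * (X - Y) + (x - y) * Y ≡ x * X - y * Y
  split = solve-∀

-- Expanding (α s + 4)^n by `binomial-coeff` turns the second sum into T n + 2σ, where σ is the sum
-- in the recurrence. The hypothesis then reads 2(T n - (1 - σ)) ≡ 0, and 2 cancels modulo N.
S-altΣ : ∀ e (α : ℕ → ℤ) → let N = 1 ℕ.+ e ℕ.* 2 in
  (∀ n → altΣ N (λ s → α s ^ n) + altΣ N (λ s → (α s + + 4) ^ n) ≡ + 2 [mod + N ]) →
  ∀ n → S n ≡ altΣ N (λ s → α s ^ n) [mod + N ]
S-altΣ e α sum≡2 = S-unique-mod (+ N) T T-rec
  where
  N = 1 ℕ.+ e ℕ.* 2
  T : ℕ → ℤ
  T n = altΣ N (λ s → α s ^ n)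
  double : ∀ t σ → t + (t + + 2 * σ) - + 2 ≡ + 2 * (t - (+ 1 - σ))
  double = solve-∀
  T-rec : ∀ n → T n ≡ + 1 - ∑[ j < n ] (coeff n (toℕ j) * T (toℕ j)) [mod + N ]
  T-rec n = ∣2*⇒∣ e _ (subst (+ N ∣ℤ_) eq (sum≡2 n))
    where
    open ≡-Reasoning
    c = λ (j : Fin n) → coeff n (toℕ j)
    σ = λ s → ∑[ j < n ] (c j * α s ^ toℕ j)
    shifted : altΣ N (λ s → (α s + + 4) ^ n) ≡ T n + + 2 * ∑[ j < n ] (c j * T (toℕ j))
    shifted = begin
      altΣ N (λ s → (α s + + 4) ^ n)                ≡⟨ altΣ-cong N (λ s → binomial-coeff (α s) n) ⟩
      altΣ N (λ s → α s ^ n + + 2 * σ s)            ≡⟨ altΣ-+ N (λ s → α s ^ n) (λ s → + 2 * σ s) ⟩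
      T n + altΣ N (λ s → + 2 * σ s)                ≡⟨ cong (λ z → T n + z) (altΣ-* N (+ 2) σ) ⟩
      T n + + 2 * altΣ N σ                          ≡⟨ cong (λ z → T n + + 2 * z)
                                                         (altΣ-sum N c (λ j s → α s ^ toℕ j)) ⟩
      T n + + 2 * ∑[ j < n ] (c j * T (toℕ j))      ∎
    eq : T n + altΣ N (λ s → (α s + + 4) ^ n) - + 2 ≡ + 2 * (T n - (+ 1 - ∑[ j < n ] (c j * T (toℕ j))))
    eq = trans (cong (λ z → T n + z - + 2) shifted) (double (T n) _)

telescope-mod : ∀ e (β : ℕ → ℤ) → let N = 1 ℕ.+ e ℕ.* 2 in
  β 0 ≡ + 1 → β N ≡ + 1 [mod + N ] →
  ∀ n → altΣ N (λ s → β s ^ n) + altΣ N (λ s → β (suc s) ^ n) ≡ + 2 [mod + N ]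
telescope-mod e β β₀≡1 βN≡1 n =
  subst (+ N ∣ℤ_) (sym eq) (^-cong-mod {x = β N} n βN≡1)
  where
  N = 1 ℕ.+ e ℕ.* 2
  rearrange : ∀ x → + 1 + x - + 2 ≡ x - + 1
  rearrange = solve-∀
  open ≡-Reasoning
  eq : altΣ N (λ s → β s ^ n) + altΣ N (λ s → β (suc s) ^ n) - + 2 ≡ β N ^ n - (+ 1) ^ n
  eq = begin
    altΣ N (λ s → β s ^ n) + altΣ N (λ s → β (suc s) ^ n) - + 2
      ≡⟨ cong (_- + 2) (altΣ-telescope e (λ s → β s ^ n)) ⟩
    β 0 ^ n + β N ^ n - + 2
      ≡⟨ cong (λ z → z ^ n + β N ^ n - + 2) β₀≡1 ⟩
    (+ 1) ^ n + β N ^ n - + 2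
      ≡⟨ cong (λ z → z + β N ^ n - + 2) (ℤₚ.^-zeroˡ n) ⟩
    + 1 + β N ^ n - + 2
      ≡⟨ rearrange (β N ^ n) ⟩
    β N ^ n - + 1
      ≡⟨ cong (λ z → β N ^ n - z) (ℤₚ.^-zeroˡ n) ⟨
    β N ^ n - (+ 1) ^ n ∎

S-altΣ-[1+4s] : ∀ e n → let N = 1 ℕ.+ e ℕ.* 2 in
  S n ≡ altΣ N (λ s → (+ 1 + + 4 * + s) ^ n) [mod + N ]
S-altΣ-[1+4s] e = S-altΣ e β λ n →
  subst (λ z → altΣ N (λ s → β s ^ n) + z ≡ + 2 [mod + N ])
    (altΣ-cong N (λ s → cong (_^ n) (step (+ s))))
    (telescope-mod e β refl (subst (+ N ∣ℤ_) (base (+ N)) (ℤ∣.∣n⇒∣m*n (+ 4) ℤ∣.∣-refl)) n)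
  where
  N = 1 ℕ.+ e ℕ.* 2
  β : ℕ → ℤ
  β s = + 1 + + 4 * + s
  step : ∀ z → + 1 + + 4 * (+ 1 + z) ≡ + 1 + + 4 * z + + 4
  step = solve-∀
  base : ∀ z → + 4 * z ≡ + 1 + + 4 * z - + 1
  base = solve-∀

-- The same telescoping along the descending progression 1 - 4s, with the two sums interchanged.
-- These bases are the ones left when -3 is taken out of the multiples of 3 among the 4r + 1.
S-altΣ-[-3-4s] : ∀ e n → let N = 1 ℕ.+ e ℕ.* 2 in
  S n ≡ altΣ N (λ s → (- + 3 - + 4 * + s) ^ n) [mod + N ]
S-altΣ-[-3-4s] e = S-altΣ e (λ s → - + 3 - + 4 * + s) λ n →
  subst (_≡ + 2 [mod + N ])
    (trans (ℤₚ.+-comm (altΣ N (λ s → β s ^ n)) _)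
      (cong₂ _+_ (altΣ-cong N (λ s → cong (_^ n) (step₁ (+ s))))
                 (altΣ-cong N (λ s → cong (_^ n) (step₂ (+ s))))))
    (telescope-mod e β refl (subst (+ N ∣ℤ_) (base (+ N)) (ℤ∣.∣n⇒∣m*n (- + 4) ℤ∣.∣-refl)) n)
  where
  N = 1 ℕ.+ e ℕ.* 2
  β : ℕ → ℤ
  β s = + 1 - + 4 * + s
  step₁ : ∀ z → + 1 - + 4 * (+ 1 + z) ≡ - + 3 - + 4 * z
  step₁ = solve-∀
  step₂ : ∀ z → + 1 - + 4 * z ≡ - + 3 - + 4 * z + + 4
  step₂ = solve-∀
  base : ∀ z → - + 4 * z ≡ + 1 - + 4 * z - + 1
  base = solve-∀

-- Separating the multiples of 3

-- The integers 4r + 1 prime to 3 are 12s + 1 (r = 3s) and 12s + 5 (r = 3s + 1); both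
-- signs (−1)^r are relative to (−1)^s.
coprimePair : (ℤ → ℤ) → ℕ → ℤ
coprimePair h s = h (+ 1 + + 12 * + s) - h (+ 5 + + 12 * + s)

μ : ℕ → (ℤ → ℤ) → ℤ
μ N h = altΣ N (coprimePair h)

^-distribʳ-* : ∀ x y n → (x * y) ^ n ≡ x ^ n * y ^ n
^-distribʳ-* x y zero    = refl
^-distribʳ-* x y (suc n) =
  trans (cong (λ z → x * y * z) (^-distribʳ-* x y n)) (swap x y (x ^ n) (y ^ n))
  where
  swap : ∀ x y X Y → x * y * (X * Y) ≡ x * X * (y * Y)
  swap = solve-∀

-- Sort r by its residue modulo 3: r = 3s and r = 3s + 1 give the pair in `μ`, while r = 3s + 2
-- gives 12s + 9 = -3(-3 - 4s).
altΣ-split : ∀ N n →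
  altΣ (N ℕ.* 3) (λ s → (+ 1 + + 4 * + s) ^ n) ≡
  μ N (_^ n) + (- + 3) ^ n * altΣ N (λ s → (- + 3 - + 4 * + s) ^ n)
altΣ-split N n = begin
  altΣ (N ℕ.* 3) f
    ≡⟨ altΣ-*3 N f ⟩
  altΣ N (λ s → f (s ℕ.* 3) - f (1 ℕ.+ s ℕ.* 3) + f (2 ℕ.+ s ℕ.* 3))
    ≡⟨ altΣ-cong N (λ s → cong₂ _+_ (cong₂ _-_ (f₀ s) (f₁ s)) (f₂ s)) ⟩
  altΣ N (λ s → (+ 1 + + 12 * + s) ^ n - (+ 5 + + 12 * + s) ^ n + (- + 3) ^ n * g s)
    ≡⟨ altΣ-+ N (coprimePair (_^ n)) (λ s → (- + 3) ^ n * g s) ⟩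
  μ N (_^ n) + altΣ N (λ s → (- + 3) ^ n * g s)
    ≡⟨ cong (λ z → μ N (_^ n) + z) (altΣ-* N ((- + 3) ^ n) g) ⟩
  μ N (_^ n) + (- + 3) ^ n * altΣ N g ∎
  where
  open ≡-Reasoning
  f g : ℕ → ℤ
  f s = (+ 1 + + 4 * + s) ^ n
  g s = (- + 3 - + 4 * + s) ^ n
  r₀ : ∀ z → + 1 + + 4 * (z * + 3) ≡ + 1 + + 12 * z
  r₀ = solve-∀
  r₁ : ∀ z → + 1 + + 4 * (+ 1 + z * + 3) ≡ + 5 + + 12 * z
  r₁ = solve-∀
  r₂ : ∀ z → + 1 + + 4 * (+ 2 + z * + 3) ≡ - + 3 * (- + 3 - + 4 * z)
  r₂ = solve-∀
  f₀ : ∀ s → f (s ℕ.* 3) ≡ (+ 1 + + 12 * + s) ^ n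
  f₀ s = cong (_^ n) (trans (cong (λ z → + 1 + + 4 * z) (ℤₚ.pos-* s 3)) (r₀ (+ s)))
  f₁ : ∀ s → f (1 ℕ.+ s ℕ.* 3) ≡ (+ 5 + + 12 * + s) ^ n
  f₁ s = cong (_^ n) (trans (cong (λ z → + 1 + + 4 * (+ 1 + z)) (ℤₚ.pos-* s 3)) (r₁ (+ s)))
  f₂ : ∀ s → f (2 ℕ.+ s ℕ.* 3) ≡ (- + 3) ^ n * g s
  f₂ s = trans
    (cong (_^ n) (trans (cong (λ z → + 1 + + 4 * (+ 2 + z)) (ℤₚ.pos-* s 3)) (r₂ (+ s))))
    (^-distribʳ-* (- + 3) (- + 3 - + 4 * + s) n)

-- S n is expressed twice, by the ascending sum of 3N terms and by the descending sum of N terms;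
-- `altΣ-split` relates the two.
S-μ : ∀ e n → let N = 1 ℕ.+ e ℕ.* 2 in
  (+ 1 - (- + 3) ^ n) * S n ≡ μ N (_^ n) [mod + N ]
S-μ e n =
  subst (+ N ∣ℤ_) eq
    (ℤ∣.∣m∣n⇒∣m-n N∣₁ (ℤ∣.∣n⇒∣m*n ((- + 3) ^ n) (S-altΣ-[-3-4s] e n)))
  where
  N = 1 ℕ.+ e ℕ.* 2
  A = altΣ N (λ s → (- + 3 - + 4 * + s) ^ n)
  -- The long sum represents S n modulo 3N, hence modulo N. The parameter 1 + 3e comes from 3(1 +
  -- 2e) = 1 + 2(1 + 3e).
  N∣₁ : S n ≡ altΣ (N ℕ.* 3) (λ s → (+ 1 + + 4 * + s) ^ n) [mod + N ]
  N∣₁ = ℤ∣.∣-trans (divides (+ 3) (trans (ℤₚ.pos-* N 3) (ℤₚ.*-comm (+ N) (+ 3))))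
    (subst (λ M → S n ≡ altΣ M (λ s → (+ 1 + + 4 * + s) ^ n) [mod + M ]) odd
      (S-altΣ-[1+4s] (1 ℕ.+ e ℕ.* 3) n))
    where
    odd : 1 ℕ.+ (1 ℕ.+ e ℕ.* 3) ℕ.* 2 ≡ N ℕ.* 3
    odd = cong (3 ℕ.+_) (trans (ℕₚ.*-assoc e 3 2) (sym (ℕₚ.*-assoc e 2 3)))
  rearrange : ∀ q s m a → s - (m + q * a) - q * (s - a) ≡ (+ 1 - q) * s - m
  rearrange = solve-∀
  eq : S n - altΣ (N ℕ.* 3) (λ s → (+ 1 + + 4 * + s) ^ n) - (- + 3) ^ n * (S n - A)
       ≡ (+ 1 - (- + 3) ^ n) * S n - μ N (_^ n)
  eq = trans (cong (λ z → S n - z - (- + 3) ^ n * (S n - A)) (altΣ-split N n))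
             (rearrange ((- + 3) ^ n) (S n) (μ N (_^ n)) A)

-- Finite differences modulo d

-- The k-th forward difference vanishes modulo d, as it does for a polynomial of degree below k.
DegreeBelow : ℤ → ℕ → (ℕ → ℤ) → Set
DegreeBelow d zero    f = ∀ c → d ∣ℤ f c
DegreeBelow d (suc k) f = DegreeBelow d k (λ c → f (suc c) - f c)

module _ {d : ℤ} where

  deg-cong : ∀ k {f g} → (∀ c → f c ≡ g c) → DegreeBelow d k f → DegreeBelow d k g
  deg-cong zero    f≗g Df c = subst (d ∣ℤ_) (f≗g c) (Df c)
  deg-cong (suc k) f≗g = deg-cong k (λ c → cong₂ _-_ (f≗g (suc c)) (f≗g c))

  deg-+ : ∀ k {f g} → DegreeBelow d k f → DegreeBelow d k g → DegreeBelow d k (λ c → f c + g c)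
  deg-+ zero    Df Dg c = ℤ∣.∣m∣n⇒∣m+n (Df c) (Dg c)
  deg-+ (suc k) {f} {g} Df Dg =
    deg-cong k (λ c → rearrange (f (suc c)) (f c) (g (suc c)) (g c)) (deg-+ k Df Dg)
    where
    rearrange : ∀ a b x y → (a - b) + (x - y) ≡ a + x - (b + y)
    rearrange = solve-∀

  deg-* : ∀ k q {f} → DegreeBelow d k f → DegreeBelow d k (λ c → q * f c)
  deg-* zero    q Df c = ℤ∣.∣n⇒∣m*n q (Df c)
  deg-* (suc k) q {f} Df = deg-cong k (λ c → factor q (f (suc c)) (f c)) (deg-* k q Df)
    where
    factor : ∀ q a b → q * (a - b) ≡ q * a - q * b
    factor = solve-∀

  deg-minus : ∀ k {f g} → DegreeBelow d k f → DegreeBelow d k g → DegreeBelow d k (λ c → f c - g c)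
  deg-minus k {f} {g} Df Dg = deg-cong k (λ c → neg (f c) (g c)) (deg-+ k Df (deg-* k (- + 1) Dg))
    where
    neg : ∀ a b → a + - + 1 * b ≡ a - b
    neg = solve-∀

  deg-suc : ∀ k {f} → DegreeBelow d k f → DegreeBelow d (suc k) f
  deg-suc zero        Df c = ℤ∣.∣m∣n⇒∣m-n (Df (suc c)) (Df c)
  deg-suc (suc k) {f} Df   = deg-suc k {λ c → f (suc c) - f c} Df

  deg-mono : ∀ {j k f} → j ℕ.≤′ k → DegreeBelow d j f → DegreeBelow d k f
  deg-mono (ℕ.≤′-reflexive refl) Df = Df
  deg-mono {f = f} (ℕ.≤′-step {k} j≤k) Df = deg-suc k {f} (deg-mono j≤k Df)

  deg-shift : ∀ k {f} → DegreeBelow d k f → DegreeBelow d k (f ∘ suc)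
  deg-shift zero    Df = Df ∘ suc
  deg-shift (suc k) Df = deg-shift k Df

  deg-altΣ : ∀ k N {f : ℕ → ℕ → ℤ} → (∀ s → DegreeBelow d k (λ c → f c s)) →
    DegreeBelow d k (λ c → altΣ N (f c))
  deg-altΣ zero    N Df c = altΣ-∣ N (λ s → Df s c)
  deg-altΣ (suc k) N {f} Df = deg-cong k (λ c → altΣ-minus N (f (suc c)) (f c)) (deg-altΣ k N Df)

  deg-const : ∀ q → DegreeBelow d 1 (λ _ → q)
  deg-const q c = divides (+ 0) (ℤₚ.+-inverseʳ q)

  module _ {x : ℕ → ℤ} {t : ℤ} (x-affine : ∀ c → x (suc c) ≡ t + x c) where

    -- Discrete Leibniz rule: the difference of x f is t f(c + 1) + x Δf, and induction on k handles
    -- the second term.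
    deg-x* : ∀ k {f} → DegreeBelow d k f → DegreeBelow d (suc k) (λ c → x c * f c)
    deg-x* k {f} Df = deg-cong k (λ c → sym (leibniz c)) (deg-+ k (deg-* k t (deg-shift k Df)) (lower k Df))
      where
      expand : ∀ t x a b → (t + x) * a - x * b ≡ t * a + x * (a - b)
      expand = solve-∀
      leibniz : ∀ c → x (suc c) * f (suc c) - x c * f c ≡ t * f (suc c) + x c * (f (suc c) - f c)
      leibniz c = trans (cong (λ y → y * f (suc c) - x c * f c) (x-affine c))
                        (expand t (x c) (f (suc c)) (f c))
      lower : ∀ k → DegreeBelow d k f → DegreeBelow d k (λ c → x c * (f (suc c) - f c))
      lower zero    Df c = ℤ∣.∣n⇒∣m*n (x c) (ℤ∣.∣m∣n⇒∣m-n (Df (suc c)) (Df c))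
      lower (suc k) Df = deg-x* k Df

    deg-x^ : ∀ n → DegreeBelow d (suc n) (λ c → x c ^ n)
    deg-x^ zero    = deg-const (+ 1)
    deg-x^ (suc n) = deg-x* (suc n) (deg-x^ n)

  -- Each difference multiplies a geometric sequence of ratio r by r - 1.
  deg-geometric : ∀ k {f} r → (∀ c → f (suc c) ≡ r * f c) →
    (∀ c → d ∣ℤ (r - + 1) ^ k * f c) → DegreeBelow d k f
  deg-geometric zero    {f} r f-geo d∣ c = subst (d ∣ℤ_) (ℤₚ.*-identityˡ (f c)) (d∣ c)
  deg-geometric (suc k) {f} r f-geo d∣ =
    deg-geometric k r (λ c → trans (cong₂ _-_ (f-geo (suc c)) (f-geo c)) (factor r (f (suc c)) (f c)))
      (λ c → subst (d ∣ℤ_)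
         (sym (trans (cong (λ z → (r - + 1) ^ k * (z - f c)) (f-geo c)) (regroup r ((r - + 1) ^ k) (f c))))
         (d∣ c))
    where
    factor : ∀ r a b → r * a - r * b ≡ r * (a - b)
    factor = solve-∀
    regroup : ∀ r R a → R * (r * a - a) ≡ (r - + 1) * R * a
    regroup = solve-∀

  -- Δf inherits one zero fewer and one degree less, so by induction it vanishes modulo d; then f is
  -- constant modulo d, with f 0 ≡ 0.
  deg-zeros : ∀ k f → DegreeBelow d k f → (∀ i → i < k → d ∣ℤ f i) → ∀ c → d ∣ℤ f c
  deg-zeros zero    f Df f₀ = Df
  deg-zeros (suc k) f Df f₀ = go
    where
    Δ∣ : ∀ c → d ∣ℤ f (suc c) - f c
    Δ∣ = deg-zeros k _ Df λ i i<k → ℤ∣.∣m∣n⇒∣m-n (f₀ (suc i) (s≤s i<k)) (f₀ i (ℕₚ.m<n⇒m<1+n i<k))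
    glue : ∀ a b → a - b + b ≡ a
    glue = solve-∀
    go : ∀ c → d ∣ℤ f c
    go zero    = f₀ 0 (s≤s z≤n)
    go (suc c) = subst (d ∣ℤ_) (glue (f (suc c)) (f c)) (ℤ∣.∣m∣n⇒∣m+n (Δ∣ c) (go c))

-- The defect a^162 - 1 and the two quintics

-- Opaque, since unification would otherwise unfold the 162-fold product.
opaque
  defect : ℤ → ℤ
  defect a = a ^ (2 ℕ.* 3 ℕ.^ 4) - + 1

  defect-def : ∀ a → defect a ≡ a ^ (2 ℕ.* 3 ℕ.^ 4) - + 1
  defect-def a = refl

weightedDefect : ℕ → ℤ → ℤ
weightedDefect b a = a ^ b * defect a

evenPoly oddPoly : ℤ → ℤ
evenPoly b =
  - + 495 + + 1350 * b + + 567 * b ^ 2 - + 162 * b ^ 3 + + 972 * b ^ 4 - + 729 * b ^ 5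
oddPoly b =
  + 1422 + + 1242 * b - + 891 * b ^ 2 - + 81 * b ^ 3 + + 243 * b ^ 4 + + 729 * b ^ 5

module _ {d : ℤ} {x : ℕ → ℤ} {t : ℤ} (x-affine : ∀ c → x (suc c) ≡ t + x c)
         {k : ℕ} (6≤k : 6 ≤ k) where

  private
    -- With k variable, `DegreeBelow d k` does not unfold into nested differences. Below,
    -- `m≤m+n 3 3` and its kin prove n + 1 ≤ 6 for the exponent n.
    monomial : ∀ {n} q → n < 6 → DegreeBelow d k (λ c → q * x c ^ n)
    monomial {n} q n<6 =
      deg-* k q (deg-mono (ℕₚ.≤⇒≤′ (ℕₚ.≤-trans n<6 6≤k)) (deg-x^ {t = t} x-affine n))

    constant : ∀ q → DegreeBelow d k (λ _ → q)
    constant q = deg-mono (ℕₚ.≤⇒≤′ (ℕₚ.≤-trans (ℕₚ.m≤m+n 1 5) 6≤k)) (deg-const q)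

    linear : ∀ q → DegreeBelow d k (λ c → q * x c)
    linear q = deg-cong k (λ c → cong (λ z → q * z) (ℤₚ.^-identityʳ (x c))) (monomial q (ℕₚ.m≤m+n 2 4))

  deg-evenPoly : DegreeBelow d k (λ c → evenPoly (x c))
  deg-evenPoly =
    deg-minus k (deg-+ k (deg-minus k (deg-+ k (deg-+ k (constant (- + 495))
      (linear (+ 1350))) (monomial (+ 567) (ℕₚ.m≤m+n 3 3))) (monomial (+ 162) (ℕₚ.m≤m+n 4 2)))
      (monomial (+ 972) (ℕₚ.m≤m+n 5 1))) (monomial (+ 729) ℕₚ.≤-refl)

  deg-oddPoly : DegreeBelow d k (λ c → oddPoly (x c))
  deg-oddPoly =
    deg-+ k (deg-+ k (deg-minus k (deg-minus k (deg-+ k (constant (+ 1422))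
      (linear (+ 1242))) (monomial (+ 891) (ℕₚ.m≤m+n 3 3))) (monomial (+ 81) (ℕₚ.m≤m+n 4 2)))
      (monomial (+ 243) (ℕₚ.m≤m+n 5 1))) (monomial (+ 729) ℕₚ.≤-refl)

-- Powers of integers prime to 3

∣-* : ∀ {c d x y} → c ∣ℤ x → d ∣ℤ y → c * d ∣ℤ x * y
∣-* {c} {y = y} c∣x d∣y = ℤ∣.∣-trans (ℤ∣.*-monoʳ-∣ c d∣y) (ℤ∣.*-monoˡ-∣ y c∣x)

∣-^ : ∀ {d x} n → d ∣ℤ x → d ^ n ∣ℤ x ^ n
∣-^ zero    d∣x = ℤ∣.∣-refl
∣-^ (suc n) d∣x = ∣-* d∣x (∣-^ n d∣x)

^-∣-^ : ∀ d m n → d ^ m ∣ℤ d ^ (m ℕ.+ n)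
^-∣-^ d m n = divides (d ^ n) (trans (ℤₚ.^-distribˡ-+-* d m n) (ℤₚ.*-comm (d ^ m) (d ^ n)))

^∣-* : ∀ d m n {x y} → d ^ m ∣ℤ x → d ^ n ∣ℤ y → d ^ (m ℕ.+ n) ∣ℤ x * y
^∣-* d m n {x} {y} d^m∣x d^n∣y =
  subst (_∣ℤ x * y) (sym (ℤₚ.^-distribˡ-+-* d m n)) (∣-* d^m∣x d^n∣y)

-- x³ - y³ = (x - y)((x - y)² + 3xy), and the second factor supplies one more 3.
cube-lift : ∀ j x y → x ≡ y [mod (+ 3) ^ suc j ] → x ^ 3 ≡ y ^ 3 [mod (+ 3) ^ (2 ℕ.+ j) ]
cube-lift j x y x≡y =
  subst ((+ 3) ^ (2 ℕ.+ j) ∣ℤ_) (factor x y)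
    (^∣-* (+ 3) 1 (suc j) 3∣ x≡y)
  where
  factor : ∀ x y → ((x - y) * (x - y) + + 3 * (x * y)) * (x - y) ≡ x * (x * (x * + 1)) - y * (y * (y * + 1))
  factor = solve-∀
  3∣ : (+ 3) ^ 1 ∣ℤ (x - y) * (x - y) + + 3 * (x * y)
  3∣ = ℤ∣.∣m∣n⇒∣m+n (ℤ∣.∣m⇒∣m*n (x - y) (ℤ∣.∣-trans (^-∣-^ (+ 3) 1 j) x≡y))
                    (ℤ∣.∣m⇒∣m*n (x * y) ℤ∣.∣-refl)

^-2*3^-suc : ∀ x j → x ^ (2 ℕ.* 3 ℕ.^ suc j) ≡ (x ^ (2 ℕ.* 3 ℕ.^ j)) ^ 3
^-2*3^-suc x j = sym (trans (ℤₚ.^-*-assoc x (2 ℕ.* 3 ℕ.^ j) 3)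
  (cong (x ^_) (trans (ℕₚ.*-assoc 2 (3 ℕ.^ j) 3) (cong (2 ℕ.*_) (ℕₚ.*-comm (3 ℕ.^ j) 3)))))

^-2*3^-lift : ∀ i j x y → x ^ 2 ≡ y ^ 2 [mod (+ 3) ^ suc i ] →
  x ^ (2 ℕ.* 3 ℕ.^ j) ≡ y ^ (2 ℕ.* 3 ℕ.^ j) [mod (+ 3) ^ suc (i ℕ.+ j) ]
^-2*3^-lift i zero    x y x²≡y² rewrite ℕₚ.+-identityʳ i = x²≡y²
^-2*3^-lift i (suc j) x y x²≡y²
  rewrite ℕₚ.+-suc i j | ^-2*3^-suc x j | ^-2*3^-suc y j =
  cube-lift (i ℕ.+ j) (x ^ (2 ℕ.* 3 ℕ.^ j)) (y ^ (2 ℕ.* 3 ℕ.^ j)) (^-2*3^-lift i j x y x²≡y²)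

-- The hypothesis a² ≡ 1 modulo 3 is the form in which "a is prime to 3" is carried from here on.
^-2*3^≡1 : ∀ j a → a ^ 2 ≡ + 1 [mod + 3 ] → a ^ (2 ℕ.* 3 ℕ.^ j) ≡ + 1 [mod (+ 3) ^ suc j ]
^-2*3^≡1 j a a²≡1 =
  subst (λ z → a ^ (2 ℕ.* 3 ℕ.^ j) ≡ z [mod (+ 3) ^ suc j ]) (ℤₚ.^-zeroˡ (2 ℕ.* 3 ℕ.^ j))
    (^-2*3^-lift 0 j a (+ 1) a²≡1)

-- With z = y - 1, y³ - 1 = z²(z + 3) + 3z. As 3^(5+i) divides z, the first summand vanishes modulo
-- 3^(11+i): each further cubing merely multiplies the defect by 3.
^-2*3^-defect : ∀ i a → a ^ 2 ≡ + 1 [mod + 3 ] →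
  a ^ (2 ℕ.* 3 ℕ.^ (4 ℕ.+ i)) - + 1 ≡ (+ 3) ^ i * defect a [mod (+ 3) ^ (10 ℕ.+ i) ]
^-2*3^-defect zero a a²≡1 = subst (λ z → z ≡ (+ 3) ^ 0 * defect a [mod (+ 3) ^ 10 ]) (defect-def a)
  (divides (+ 0) (trans (cong (λ z → defect a - z) (ℤₚ.*-identityˡ (defect a))) (ℤₚ.+-inverseʳ (defect a))))
^-2*3^-defect (suc i) a a²≡1 =
  subst ((+ 3) ^ (11 ℕ.+ i) ∣ℤ_)
    (sym (trans (cong (λ z → z - + 1 - (+ 3) ^ suc i * defect a) (^-2*3^-suc a (4 ℕ.+ i)))
                (split y ((+ 3) ^ i) (defect a))))
    (ℤ∣.∣m∣n⇒∣m+n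
      (^∣-* (+ 3) 6 (5 ℕ.+ i) (^∣-* (+ 3) 5 1 (ℤ∣.∣-trans (^-∣-^ (+ 3) 5 i) y≡1) 3∣y+2) y≡1)
      (^∣-* (+ 3) 1 (10 ℕ.+ i) ℤ∣.∣-refl (^-2*3^-defect i a a²≡1)))
  where
  y = a ^ (2 ℕ.* 3 ℕ.^ (4 ℕ.+ i))
  y≡1 : y ≡ + 1 [mod (+ 3) ^ (5 ℕ.+ i) ]
  y≡1 = ^-2*3^≡1 (4 ℕ.+ i) a a²≡1
  3∣y+2 : (+ 3) ^ 1 ∣ℤ y - + 1 + + 3
  3∣y+2 = ℤ∣.∣m∣n⇒∣m+n (ℤ∣.∣-trans (^-∣-^ (+ 3) 1 (4 ℕ.+ i)) y≡1) ℤ∣.∣-refl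
  split : ∀ y p w → y * (y * (y * + 1)) - + 1 - + 3 * p * w ≡
    (y - + 1) * (y - + 1 + + 3) * (y - + 1) + + 3 * (y - + 1 - p * w)
  split = solve-∀

-- The expansion of (1 + (y - 1))^k up to its linear term.
^-linearise : ∀ k y → y ^ k - + 1 ≡ + k * (y - + 1) [mod (y - + 1) * (y - + 1) ]
^-linearise zero    y = divides (+ 0) refl
^-linearise (suc k) y =
  subst ((y - + 1) * (y - + 1) ∣ℤ_) (sym (split y (y ^ k) (+ k)))
    (ℤ∣.∣m∣n⇒∣m+n (ℤ∣.∣n⇒∣m*n y (^-linearise k y)) (ℤ∣.∣n⇒∣m*n (+ k) ℤ∣.∣-refl))
  where
  split : ∀ y Y k → y * Y - + 1 - (+ 1 + k) * (y - + 1) ≡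
    y * (Y - + 1 - k * (y - + 1)) + k * ((y - + 1) * (y - + 1))
  split = solve-∀

^-k*2*3^ : ∀ i k a → a ^ 2 ≡ + 1 [mod + 3 ] →
  a ^ (k ℕ.* (2 ℕ.* 3 ℕ.^ (4 ℕ.+ i))) - + 1 ≡ + k * (+ 3) ^ i * defect a [mod (+ 3) ^ (10 ℕ.+ i) ]
^-k*2*3^ i k a a²≡1 =
  subst (λ z → z - + 1 ≡ + k * (+ 3) ^ i * defect a [mod (+ 3) ^ (10 ℕ.+ i) ])
    (trans (ℤₚ.^-*-assoc a e k) (cong (a ^_) (ℕₚ.*-comm e k)))
    (subst ((+ 3) ^ (10 ℕ.+ i) ∣ℤ_) (glue (y ^ k) (+ k) (y - + 1) ((+ 3) ^ i) (defect a))
      (ℤ∣.∣m∣n⇒∣m+n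
        -- The quadratic error (y - 1)² is divisible by 3^5 · 3^(5+i), exactly the modulus.
        (ℤ∣.∣-trans (^∣-* (+ 3) 5 (5 ℕ.+ i) (ℤ∣.∣-trans (^-∣-^ (+ 3) 5 i) y≡1) y≡1) (^-linearise k y))
        (ℤ∣.∣n⇒∣m*n (+ k) (^-2*3^-defect i a a²≡1))))
  where
  e = 2 ℕ.* 3 ℕ.^ (4 ℕ.+ i)
  y = a ^ e
  y≡1 : y ≡ + 1 [mod (+ 3) ^ (5 ℕ.+ i) ]
  y≡1 = ^-2*3^≡1 (4 ℕ.+ i) a a²≡1
  glue : ∀ Y k z p w → Y - + 1 - k * z + k * (z - p * w) ≡ Y - + 1 - k * p * w
  glue = solve-∀

3^5∣defect : ∀ a → a ^ 2 ≡ + 1 [mod + 3 ] → (+ 3) ^ 5 ∣ℤ defect a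
3^5∣defect a a²≡1 = subst ((+ 3) ^ 5 ∣ℤ_) (sym (defect-def a)) (^-2*3^≡1 4 a a²≡1)

defect-cong : ∀ x y → x ^ 2 ≡ y ^ 2 [mod (+ 3) ^ 6 ] → defect x ≡ defect y [mod (+ 3) ^ 10 ]
defect-cong x y x²≡y² = subst ((+ 3) ^ 10 ∣ℤ_)
  (trans (shift (x ^ e) (y ^ e)) (sym (cong₂ _-_ (defect-def x) (defect-def y))))
  -- Four cubings raise the modulus from 3^6 to 3^10.
  (^-2*3^-lift 5 4 x y x²≡y²)
  where
  e = 2 ℕ.* 3 ℕ.^ 4
  shift : ∀ X Y → X - Y ≡ X - + 1 - (Y - + 1)
  shift = solve-∀

3^5∣weightedDefect : ∀ b a → a ^ 2 ≡ + 1 [mod + 3 ] → (+ 3) ^ 5 ∣ℤ weightedDefect b a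
3^5∣weightedDefect b a a²≡1 = ℤ∣.∣n⇒∣m*n (a ^ b) (3^5∣defect a a²≡1)

-- Product rule for differences: the change of the defect vanishes modulo 3^10, and the change of
-- the power contributes 3^6 next to the 3^5 in the defect.
weightedDefect-cong : ∀ b x y → y ^ 2 ≡ + 1 [mod + 3 ] → x ≡ y [mod (+ 3) ^ 6 ] →
  weightedDefect b x ≡ weightedDefect b y [mod (+ 3) ^ 10 ]
weightedDefect-cong b x y y²≡1 x≡y =
  subst ((+ 3) ^ 10 ∣ℤ_) (split (x ^ b) (y ^ b) (defect x) (defect y))
    (ℤ∣.∣m∣n⇒∣m+n
      (ℤ∣.∣n⇒∣m*n (x ^ b) (defect-cong x y (^-cong-mod {x = x} {y} 2 x≡y)))
      (ℤ∣.∣-trans (^-∣-^ (+ 3) 10 1)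
        (^∣-* (+ 3) 6 5 (^-cong-mod {x = x} {y} b x≡y) (3^5∣defect y y²≡1))))
  where
  split : ∀ X Y U V → X * (U - V) + (X - Y) * V ≡ X * U - Y * V
  split = solve-∀

-- The sum of weighted defects as a polynomial in b

[1+12s]²≡1 : ∀ s → (+ 1 + + 12 * s) ^ 2 ≡ + 1 [mod + 3 ]
[1+12s]²≡1 s = divides (+ 8 * s + + 48 * (s * s)) (expand s)
  where
  expand : ∀ s → (+ 1 + + 12 * s) * ((+ 1 + + 12 * s) * + 1) - + 1 ≡ (+ 8 * s + + 48 * (s * s)) * + 3
  expand = solve-∀

[5+12s]²≡1 : ∀ s → (+ 5 + + 12 * s) ^ 2 ≡ + 1 [mod + 3 ]
[5+12s]²≡1 s = divides (+ 8 + + 40 * s + + 48 * (s * s)) (expand s)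
  where
  expand : ∀ s → (+ 5 + + 12 * s) * ((+ 5 + + 12 * s) * + 1) - + 1 ≡ (+ 8 + + 40 * s + + 48 * (s * s)) * + 3
  expand = solve-∀

μ-∣ : ∀ {d} N {h} → (∀ a → a ^ 2 ≡ + 1 [mod + 3 ] → d ∣ℤ h a) → d ∣ℤ μ N h
μ-∣ N d∣h = altΣ-∣ N λ s → ℤ∣.∣m∣n⇒∣m-n (d∣h _ ([1+12s]²≡1 (+ s))) (d∣h _ ([5+12s]²≡1 (+ s)))

μ-minus : ∀ N g h → μ N (λ a → g a - h a) ≡ μ N g - μ N h
μ-minus N g h = trans
  (altΣ-cong N (λ s → swap (g (+ 1 + + 12 * + s)) (h (+ 1 + + 12 * + s))
                             (g (+ 5 + + 12 * + s)) (h (+ 5 + + 12 * + s))))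
  (altΣ-minus N (coprimePair g) (coprimePair h))
  where
  swap : ∀ a b c d → a - b - (c - d) ≡ a - c - (b - d)
  swap = solve-∀

μ-* : ∀ N c h → μ N (λ a → c * h a) ≡ c * μ N h
μ-* N c h = trans
  (altΣ-cong N (λ s → factor c (h (+ 1 + + 12 * + s)) (h (+ 5 + + 12 * + s))))
  (altΣ-* N c (coprimePair h))
  where
  factor : ∀ c a b → c * a - c * b ≡ c * (a - b)
  factor = solve-∀

Odd : ℕ → Set
Odd n = ∃ λ e → n ≡ 1 ℕ.+ e ℕ.* 2

3^-odd : ∀ M → Odd (3 ℕ.^ M)
3^-odd zero = 0 , refl
3^-odd (suc M) with 3^-odd M
... | e , eq = 1 ℕ.+ 3 ℕ.* e , trans (cong (3 ℕ.*_) eq)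
      (trans (ℕₚ.*-distribˡ-+ 3 1 (e ℕ.* 2)) (cong (3 ℕ.+_) (sym (ℕₚ.*-assoc 3 e 2))))

-- Replacing s by s + p moves both bases by 12p, a multiple of 3^6, so `weightedDefect-cong` gives
-- the period p needed for `altΣ-periodic`.
μ-periodic : ∀ {q p} b → Odd q → Odd p → (+ 3) ^ 6 ∣ℤ + 12 * + p →
  μ (q ℕ.* p) (weightedDefect b) ≡ μ p (weightedDefect b) [mod (+ 3) ^ 10 ]
μ-periodic {p = p} b (t , refl) (e , refl) 3^6∣ = altΣ-periodic e t (coprimePair f) λ s →
  subst ((+ 3) ^ 10 ∣ℤ_)
    (swap (f (+ 1 + + 12 * (+ p + + s))) (f (+ 1 + + 12 * + s))
          (f (+ 5 + + 12 * (+ p + + s))) (f (+ 5 + + 12 * + s)))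
    (ℤ∣.∣m∣n⇒∣m-n (f-periodic (+ 1) s ([1+12s]²≡1 (+ s))) (f-periodic (+ 5) s ([5+12s]²≡1 (+ s))))
  where
  f = weightedDefect b
  shift : ∀ r p s → + 12 * p ≡ r + + 12 * (p + s) - (r + + 12 * s)
  shift = solve-∀
  f-periodic : ∀ r s → (r + + 12 * + s) ^ 2 ≡ + 1 [mod + 3 ] →
    f (r + + 12 * (+ p + + s)) ≡ f (r + + 12 * + s) [mod (+ 3) ^ 10 ]
  f-periodic r s unit = weightedDefect-cong b (r + + 12 * (+ p + + s)) (r + + 12 * + s) unit
    (subst ((+ 3) ^ 6 ∣ℤ_) (shift r (+ p) (+ s)) 3^6∣)
  swap : ∀ a b c d → a - b - (c - d) ≡ a - c - (b - d)
  swap = solve-∀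

-- The offset is added on the right so that suc c increases the exponent by 2
-- definitionally.
deg-weightedDefect : ∀ ε a → a ^ 2 ≡ + 1 [mod + 3 ] →
  DegreeBelow ((+ 3) ^ 10) 6 (λ c → weightedDefect (c ℕ.* 2 ℕ.+ ε) a)
deg-weightedDefect ε a a²≡1 = deg-geometric 6 (a ^ 2)
  (λ c → assoc a (a ^ (c ℕ.* 2 ℕ.+ ε)) (defect a))
  -- The ratio is a², so (a² - 1)^6 contributes 3^6 and the defect 3^5.
  (λ c → ℤ∣.∣-trans (^-∣-^ (+ 3) 10 1) (^∣-* (+ 3) 6 5 (∣-^ 6 a²≡1)
                                            (3^5∣weightedDefect (c ℕ.* 2 ℕ.+ ε) a a²≡1)))
  where
  assoc : ∀ a A w → a * (a * A) * w ≡ a * (a * + 1) * (A * w)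
  assoc = solve-∀

deg-μ-weightedDefect : ∀ ε N → DegreeBelow ((+ 3) ^ 10) 6 (λ c → μ N (weightedDefect (c ℕ.* 2 ℕ.+ ε)))
deg-μ-weightedDefect ε N = deg-altΣ 6 N λ s →
  deg-minus 6 {λ c → weightedDefect (c ℕ.* 2 ℕ.+ ε) (+ 1 + + 12 * + s)}
              {λ c → weightedDefect (c ℕ.* 2 ℕ.+ ε) (+ 5 + + 12 * + s)}
    (deg-weightedDefect ε (+ 1 + + 12 * + s) ([1+12s]²≡1 (+ s)))
    (deg-weightedDefect ε (+ 5 + + 12 * + s) ([5+12s]²≡1 (+ s)))

-- Both sides have vanishing sixth difference, so `deg-zeros` reduces the claim to six values. The
-- factor 27 is the quotient of 3^(m-2) by 3^(m-5).
μ-weightedDefect-poly : ∀ N ε (P : ℤ → ℤ) →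
  DegreeBelow ((+ 3) ^ 10) 6 (λ c → P (+ (c ℕ.* 2 ℕ.+ ε))) →
  (∀ (i : Fin 6) → μ N (weightedDefect (toℕ i ℕ.* 2 ℕ.+ ε))
                     ≡ + 27 * P (+ (toℕ i ℕ.* 2 ℕ.+ ε)) [mod (+ 3) ^ 10 ]) →
  ∀ c → μ N (weightedDefect (c ℕ.* 2 ℕ.+ ε)) ≡ + 27 * P (+ (c ℕ.* 2 ℕ.+ ε)) [mod (+ 3) ^ 10 ]
μ-weightedDefect-poly N ε P DP initial =
  deg-zeros 6 δ (deg-minus 6 {λ c → μ N (weightedDefect (c ℕ.* 2 ℕ.+ ε))}
                           {λ c → + 27 * P (+ (c ℕ.* 2 ℕ.+ ε))}
                  (deg-μ-weightedDefect ε N) (deg-* 6 (+ 27) {λ c → P (+ (c ℕ.* 2 ℕ.+ ε))} DP))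
    λ i i<6 → subst (λ j → (+ 3) ^ 10 ∣ℤ δ j) (toℕ-fromℕ< i<6) (initial (fromℕ< i<6))
  where
  δ : ℕ → ℤ
  δ c = μ N (weightedDefect (c ℕ.* 2 ℕ.+ ε)) - + 27 * P (+ (c ℕ.* 2 ℕ.+ ε))

opaque
  unfolding defect

  -- The cases b = 0, 2, ..., 10 are decided by evaluation. The length 243 suffices for every m,
  -- because 12 · 243 = 4 · 3^6 makes it a period.
  μ-weightedDefect-even : ∀ c →
    μ 243 (weightedDefect (c ℕ.* 2 ℕ.+ 0)) ≡ + 27 * evenPoly (+ (c ℕ.* 2 ℕ.+ 0)) [mod (+ 3) ^ 10 ]
  μ-weightedDefect-even = μ-weightedDefect-poly 243 0 evenPoly
    (deg-evenPoly {x = λ c → + (c ℕ.* 2 ℕ.+ 0)} {t = + 2} (λ c → refl) ℕₚ.≤-refl)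
    (toWitness {a? = all? λ i → (+ 3) ^ 10 ℤ∣.∣? μ 243 (weightedDefect (toℕ i ℕ.* 2 ℕ.+ 0))
                                           - + 27 * evenPoly (+ (toℕ i ℕ.* 2 ℕ.+ 0))} _)

  μ-weightedDefect-odd : ∀ c →
    μ 243 (weightedDefect (c ℕ.* 2 ℕ.+ 1)) ≡ + 27 * oddPoly (+ (c ℕ.* 2 ℕ.+ 1)) [mod (+ 3) ^ 10 ]
  μ-weightedDefect-odd = μ-weightedDefect-poly 243 1 oddPoly
    (deg-oddPoly {x = λ c → + (c ℕ.* 2 ℕ.+ 1)} {t = + 2} (λ c → refl) ℕₚ.≤-refl)
    (toWitness {a? = all? λ i → (+ 3) ^ 10 ℤ∣.∣? μ 243 (weightedDefect (toℕ i ℕ.* 2 ℕ.+ 1))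
                                           - + 27 * oddPoly (+ (toℕ i ℕ.* 2 ℕ.+ 1))} _)

-- Euler's totient at powers of 3

-- A common divisor d of i and p · p^k is prime to p because p ∤ i, so it already divides p^k.
∤⇒coprime-^ : ∀ {p} → Prime p → ∀ k {i} → p ∤ i → Coprime i (p ℕ.^ k)
∤⇒coprime-^ p-prime zero    p∤i (_ , d∣1)      = ℕ∣.∣1⇒≡1 d∣1
∤⇒coprime-^ {p} p-prime (suc k) {i} p∤i {d} (d∣i , d∣p^) =
  ∤⇒coprime-^ p-prime k p∤i (d∣i , coprime-divisor d⊥p d∣p^)
  where
  d⊥p : Coprime d p
  d⊥p (e∣d , e∣p) with prime⇒irreducible p-prime e∣p
  ... | inj₁ e≡1  = e≡1
  ... | inj₂ refl = contradiction (ℕ∣.∣-trans e∣d d∣i) p∤i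

coprime-^⇒∤ : ∀ {p} → 1 ℕ.< p → ∀ k {i} → Coprime i (p ℕ.^ suc k) → p ∤ i
coprime-^⇒∤ 1<p k i⊥p^ p∣i = ℕₚ.<⇒≢ 1<p (sym (i⊥p^ (p∣i , ℕ∣.m∣m*n _)))

-- Three entries are consumed at a time, of which two survive; g is arbitrary because the recursion
-- shifts it. For g = `suc` the multiple of 3 comes last in each triple.
length-filter-3∤ : ∀ g n →
  (∀ s → 3 ∤ g (s ℕ.* 3)) → (∀ s → 3 ∤ g (1 ℕ.+ s ℕ.* 3)) → (∀ s → 3 ∣ g (2 ℕ.+ s ℕ.* 3)) →
  length (filter (λ i → ¬? (3 ∣? i)) (applyUpTo g (n ℕ.* 3))) ≡ 2 ℕ.* n
length-filter-3∤ g zero    _  _  _  = refl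
length-filter-3∤ g (suc n) g₀ g₁ g₂ = begin
  length (filter 3∤? (g 0 ∷ g 1 ∷ g 2 ∷ gs)) ≡⟨ cong length (filter-accept 3∤? (g₀ 0)) ⟩
  suc (length (filter 3∤? (g 1 ∷ g 2 ∷ gs))) ≡⟨ cong (suc ∘ length) (filter-accept 3∤? (g₁ 0)) ⟩
  2 ℕ.+ length (filter 3∤? (g 2 ∷ gs))       ≡⟨ cong ((2 ℕ.+_) ∘ length) (filter-reject 3∤? (λ 3∤ → 3∤ (g₂ 0))) ⟩
  2 ℕ.+ length (filter 3∤? gs)               ≡⟨ cong (2 ℕ.+_) (length-filter-3∤ (λ s → g (3 ℕ.+ s)) n
                                                                  (g₀ ∘ suc) (g₁ ∘ suc) (g₂ ∘ suc)) ⟩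
  2 ℕ.+ 2 ℕ.* n                              ≡⟨ ℕₚ.*-suc 2 n ⟨
  2 ℕ.* suc n                                ∎
  where
  open ≡-Reasoning
  3∤? = λ i → ¬? (3 ∣? i)
  gs = applyUpTo (λ s → g (3 ℕ.+ s)) (n ℕ.* 3)

φ-3^ : ∀ k → φ (3 ℕ.^ suc k) ≡ 2 ℕ.* 3 ℕ.^ k
φ-3^ k = begin
  φ (3 ℕ.^ suc k)
    ≡⟨ cong length (filter-≐ (λ i → coprime? i (3 ℕ.^ suc k)) (λ i → ¬? (3 ∣? i))
                     (coprime-^⇒∤ (s≤s (s≤s z≤n)) k , ∤⇒coprime-^ (toWitness {a? = prime? 3} _) (suc k))
                     (map suc (upTo (3 ℕ.^ suc k)))) ⟩
  length (filter (λ i → ¬? (3 ∣? i)) (map suc (upTo (3 ℕ.^ suc k))))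
    ≡⟨ cong (length ∘ filter (λ i → ¬? (3 ∣? i))) (map-upTo suc (3 ℕ.^ suc k)) ⟩
  length (filter (λ i → ¬? (3 ∣? i)) (applyUpTo suc (3 ℕ.* 3 ℕ.^ k)))
    ≡⟨ cong (λ n → length (filter (λ i → ¬? (3 ∣? i)) (applyUpTo suc n))) (ℕₚ.*-comm 3 (3 ℕ.^ k)) ⟩
  length (filter (λ i → ¬? (3 ∣? i)) (applyUpTo suc (3 ℕ.^ k ℕ.* 3)))
    ≡⟨ length-filter-3∤ suc (3 ℕ.^ k)
         (λ s → 3∤r+s*3 1 s (ℕ∣.>⇒∤ (s≤s (s≤s z≤n)))) (λ s → 3∤r+s*3 2 s (ℕ∣.>⇒∤ (s≤s (s≤s (s≤s z≤n)))))
         (λ s → ℕ∣.∣m∣n⇒∣m+n ℕ∣.∣-refl (ℕ∣.n∣m*n s)) ⟩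
  2 ℕ.* 3 ℕ.^ k ∎
  where
  open ≡-Reasoning

  3∤r+s*3 : ∀ r s → 3 ∤ r → 3 ∤ r ℕ.+ s ℕ.* 3
  3∤r+s*3 r s 3∤r 3∣ = 3∤r (ℕ∣.∣m+n∣m⇒∣n (subst (3 ∣_) (ℕₚ.+-comm r (s ℕ.* 3)) 3∣) (ℕ∣.n∣m*n s))

-- Assembling the congruence

10+i≤2*3^[4+i] : ∀ i → 10 ℕ.+ i ≤ 2 ℕ.* 3 ℕ.^ (4 ℕ.+ i)
10+i≤2*3^[4+i] zero    = ℕₚ.m≤m+n 10 152
10+i≤2*3^[4+i] (suc i) = begin
  1 ℕ.+ (10 ℕ.+ i)                ≤⟨ ℕₚ.+-mono-≤ (ℕₚ.≤-trans (s≤s z≤n) IH) IH ⟩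
  2 ℕ.* t ℕ.+ 2 ℕ.* t             ≡⟨ ℕₚ.*-distribˡ-+ 2 t t ⟨
  2 ℕ.* (t ℕ.+ t)                 ≤⟨ ℕₚ.*-monoʳ-≤ 2 (ℕₚ.+-monoʳ-≤ t (ℕₚ.m≤m+n t (t ℕ.+ 0))) ⟩
  2 ℕ.* (3 ℕ.* t)                 ∎
  where
  open ℕₚ.≤-Reasoning
  t = 3 ℕ.^ (4 ℕ.+ i)
  IH = 10+i≤2*3^[4+i] i

3^∣[-3]^ : ∀ {m n} → m ≤ n → (+ 3) ^ m ∣ℤ (- + 3) ^ n
3^∣[-3]^ {m} {n} m≤n with ℕₚ.m≤n⇒∃[o]m+o≡n m≤n
... | o , refl = ℤ∣.∣-trans (∣-^ m (divides (- + 1) refl)) (^-∣-^ (- + 3) m o)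

-- The final chain in bare variables: s = S n, q = (-3)^n, t = (1 - (-3)^b) S b, `mₙ` and `m_b` are
-- the power sums, and F, G are the sums of weighted defects of lengths N and L.
mod-chain : ∀ {d} s q t mₙ m_b K F G Q →
  (+ 1 - q) * s ≡ mₙ [mod d ] → d ∣ℤ q → t ≡ m_b [mod d ] →
  mₙ - m_b ≡ K * F [mod d ] → d ∣ℤ K * (F - G) → d ∣ℤ K * (G - + 27 * Q) →
  s - t ≡ K * (+ 27 * Q) [mod d ]
mod-chain {d} s q t mₙ m_b K F G Q s≡mₙ d∣q t≡m_b diff≡KF F≡G G≡Q =
  subst (d ∣ℤ_)
    (trans (cong (λ z → z + K * (F - G) + K * (G - + 27 * Q)) (left s q t mₙ m_b (K * F)))
           (right s t K F G Q))
    (ℤ∣.∣m∣n⇒∣m+n (ℤ∣.∣m∣n⇒∣m+n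
      (ℤ∣.∣m∣n⇒∣m+n (ℤ∣.∣m∣n⇒∣m-n (ℤ∣.∣m∣n⇒∣m+n s≡mₙ (ℤ∣.∣m⇒∣m*n s d∣q)) t≡m_b) diff≡KF)
      F≡G) G≡Q)
  where
  left : ∀ s q t mₙ m_b x → (+ 1 - q) * s - mₙ + q * s - (t - m_b) + (mₙ - m_b - x) ≡ s - t - x
  left = solve-∀
  right : ∀ s t K F G Q → s - t - K * F + K * (F - G) + K * (G - + 27 * Q) ≡ s - t - K * (+ 27 * Q)
  right = solve-∀

-- L is 243, kept variable because conversion checking would unfold the sum μ 243.
module _ (i k b : ℕ) (1≤k : 1 ≤ k) (Q : ℤ) {L : ℕ} (L≡3^5 : L ≡ 3 ℕ.^ 5)
         (μ≡Q : μ L (weightedDefect b) ≡ + 27 * Q [mod (+ 3) ^ 10 ]) where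

  private
    e n N : ℕ
    e = k ℕ.* (2 ℕ.* 3 ℕ.^ (4 ℕ.+ i))
    n = e ℕ.+ b
    N = 3 ℕ.^ (10 ℕ.+ i)

    M p K : ℤ
    M = (+ 3) ^ (10 ℕ.+ i)
    p = (+ 3) ^ i
    K = + k * p

    +3^ : ∀ j → + (3 ℕ.^ j) ≡ (+ 3) ^ j
    +3^ zero    = refl
    +3^ (suc j) = trans (ℤₚ.pos-* 3 (3 ℕ.^ j)) (cong (λ z → + 3 * z) (+3^ j))

    S-μ-N : ∀ n → (+ 1 - (- + 3) ^ n) * S n ≡ μ N (_^ n) [mod M ]
    S-μ-N n = subst (λ d → (+ 1 - (- + 3) ^ n) * S n ≡ μ N (_^ n) [mod d ])
      (+3^ (10 ℕ.+ i)) (go (3^-odd (10 ℕ.+ i)))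
      where
      go : ∀ {N} → Odd N → (+ 1 - (- + 3) ^ n) * S n ≡ μ N (_^ n) [mod + N ]
      go (e , refl) = S-μ e n

    [-3]^n : M ∣ℤ (- + 3) ^ n
    -- The exponent n is at least 10 + i, so 1 - (-3)^n may be replaced by 1.
    [-3]^n = 3^∣[-3]^ (begin
      10 ℕ.+ i                       ≤⟨ 10+i≤2*3^[4+i] i ⟩
      2 ℕ.* 3 ℕ.^ (4 ℕ.+ i)          ≡⟨ ℕₚ.*-identityˡ _ ⟨
      1 ℕ.* (2 ℕ.* 3 ℕ.^ (4 ℕ.+ i))  ≤⟨ ℕₚ.*-monoˡ-≤ _ 1≤k ⟩
      e                              ≤⟨ ℕₚ.m≤m+n e b ⟩
      n                              ∎)
      where open ℕₚ.≤-Reasoning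

    μ-diff : M ∣ℤ μ N (_^ n) - μ N (_^ b) - K * μ N (weightedDefect b)
    μ-diff = subst (M ∣ℤ_) eq (μ-∣ N λ a a²≡1 →
      subst (M ∣ℤ_) (sym (pointwise a)) (ℤ∣.∣n⇒∣m*n (a ^ b) (^-k*2*3^ i k a a²≡1)))
      where
      factor : ∀ A B k p w → A * B - B - k * p * (B * w) ≡ B * (A - + 1 - k * p * w)
      factor = solve-∀
      pointwise : ∀ a → a ^ n - a ^ b - K * weightedDefect b a ≡ a ^ b * (a ^ e - + 1 - K * defect a)
      pointwise a = trans (cong (λ z → z - a ^ b - K * weightedDefect b a) (ℤₚ.^-distribˡ-+-* a e b))
                          (factor (a ^ e) (a ^ b) (+ k) p (defect a))
      eq : μ N (λ a → a ^ n - a ^ b - K * weightedDefect b a)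
             ≡ μ N (_^ n) - μ N (_^ b) - K * μ N (weightedDefect b)
      eq = trans (μ-minus N (λ a → a ^ n - a ^ b) (λ a → K * weightedDefect b a))
                 (cong₂ _-_ (μ-minus N (_^ n) (_^ b)) (μ-* N K (weightedDefect b)))

    scale : ∀ {x} → (+ 3) ^ 10 ∣ℤ x → M ∣ℤ K * x
    scale {x} 3^10∣x = subst (M ∣ℤ_) (swap (+ k) p x)
      (ℤ∣.∣n⇒∣m*n (+ k) (^∣-* (+ 3) 10 i 3^10∣x ℤ∣.∣-refl))
      where
      swap : ∀ k p x → k * (x * p) ≡ k * p * x
      swap = solve-∀

    μ-N : μ N (weightedDefect b) ≡ μ L (weightedDefect b) [mod (+ 3) ^ 10 ]
    μ-N = subst (λ N → μ N (weightedDefect b) ≡ μ L (weightedDefect b) [mod (+ 3) ^ 10 ]) eq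
      -- Here 243 = 1 + 2 · 121 shows that L is odd, and 12 · 243 = 4 · 3^6.
      (μ-periodic b (3^-odd (5 ℕ.+ i)) (121 , L≡3^5)
        (divides (+ 4) (cong (λ L → + 12 * + L) L≡3^5)))
      where
      eq : 3 ℕ.^ (5 ℕ.+ i) ℕ.* L ≡ N
      eq = trans (ℕₚ.*-comm (3 ℕ.^ (5 ℕ.+ i)) L)
             (trans (cong (ℕ._* 3 ℕ.^ (5 ℕ.+ i)) L≡3^5) (sym (ℕₚ.^-distribˡ-+-* 3 5 (5 ℕ.+ i))))

  -- For m = 5 + i: φ(3^m) = 2 · 3^(4+i), the modulus 3^(m+5) is 3^(10+i), and 27 · 3^i = 3^(m-2).
  S-kφ+b : S (k ℕ.* φ (3 ℕ.^ (5 ℕ.+ i)) ℕ.+ b) - (+ 1 - (- + 3) ^ b) * S b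
    ≡ (+ 3) ^ (3 ℕ.+ i) * + k * Q [mod M ]
  S-kφ+b = subst₂ (λ f r → S (k ℕ.* f ℕ.+ b) - (+ 1 - (- + 3) ^ b) * S b ≡ r [mod M ])
    (sym (φ-3^ (4 ℕ.+ i))) (regroup (+ k) p Q)
    (mod-chain (S n) ((- + 3) ^ n) ((+ 1 - (- + 3) ^ b) * S b) (μ N (_^ n)) (μ N (_^ b)) K
      (μ N (weightedDefect b)) (μ L (weightedDefect b)) Q
      (S-μ-N n) [-3]^n (S-μ-N b) μ-diff (scale μ-N) (scale μ≡Q))
    where
    regroup : ∀ k p Q → k * p * (+ 27 * Q) ≡ + 3 * (+ 3 * (+ 3 * p)) * k * Q
    regroup = solve-∀

S-congruence : ∀ k m b → 1 ≤ k → 5 ≤ m → ∀ Q {L} → L ≡ 3 ℕ.^ 5 →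
  μ L (weightedDefect b) ≡ + 27 * Q [mod (+ 3) ^ 10 ] →
  S (k ℕ.* φ (3 ℕ.^ m) ℕ.+ b) - (+ 1 - (- + 3) ^ b) * S b
    ≡ (+ 3) ^ (m ∸ 2) * + k * Q [mod (+ 3) ^ (m ℕ.+ 5) ]
S-congruence k m b 1≤k 5≤m Q L≡3^5 μ≡Q with ℕₚ.m≤n⇒∃[o]m+o≡n 5≤m
... | i , refl =
  subst (λ j → S (k ℕ.* φ (3 ℕ.^ (5 ℕ.+ i)) ℕ.+ b) - (+ 1 - (- + 3) ^ b) * S b
                 ≡ (+ 3) ^ (3 ℕ.+ i) * + k * Q [mod (+ 3) ^ j ])
    (cong (5 ℕ.+_) (ℕₚ.+-comm 5 i)) (S-kφ+b i k b 1≤k Q L≡3^5 μ≡Q)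

parity : ∀ b → ∃ λ c → b ≡ c ℕ.* 2 ℕ.+ 0 ⊎ b ≡ c ℕ.* 2 ℕ.+ 1
parity zero = 0 , inj₁ refl
parity (suc b) with parity b
... | c , inj₁ refl = c , inj₂ (sym (ℕₚ.+-suc (c ℕ.* 2) 0))
... | c , inj₂ refl = suc c , inj₁ (cong suc (ℕₚ.+-suc (c ℕ.* 2) 0))

2∤⇒odd : ∀ b → 2 ∤ b → ∃ λ c → b ≡ c ℕ.* 2 ℕ.+ 1
2∤⇒odd b 2∤b with parity b
... | c , inj₁ b≡ = contradiction (ℕ∣.divides c (trans b≡ (ℕₚ.+-identityʳ (c ℕ.* 2)))) 2∤b
... | c , inj₂ b≡ = c , b≡

μ-even : ∀ b → 2 ∣ b → μ 243 (weightedDefect b) ≡ + 27 * evenPoly (+ b) [mod (+ 3) ^ 10 ]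
μ-even b (ℕ∣.divides c b≡c*2) =
  subst (λ b → μ 243 (weightedDefect b) ≡ + 27 * evenPoly (+ b) [mod (+ 3) ^ 10 ])
    (sym (trans b≡c*2 (sym (ℕₚ.+-identityʳ (c ℕ.* 2))))) (μ-weightedDefect-even c)

μ-odd : ∀ {b} → (∃ λ c → b ≡ c ℕ.* 2 ℕ.+ 1) →
  μ 243 (weightedDefect b) ≡ + 27 * oddPoly (+ b) [mod (+ 3) ^ 10 ]
μ-odd (c , b≡) =
  subst (λ b → μ 243 (weightedDefect b) ≡ + 27 * oddPoly (+ b) [mod (+ 3) ^ 10 ])
    (sym b≡) (μ-weightedDefect-odd c)

theorem5p1 : ∀ (k m b : ℕ) → 1 ≤ k → 5 ≤ m →
    (2 ∣ b →
    S (k ℕ.* φ (3 ℕ.^ m) ℕ.+ b) - (+ 1 - (- + 3) ^ b) * S b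
    ≡ (+ 3) ^ (m ∸ 2) * + k *
    (- + 495 + + 1350 * + b + + 567 * (+ b) ^ 2 - + 162 * (+ b) ^ 3
    + + 972 * (+ b) ^ 4 - + 729 * (+ b) ^ 5)
    [mod (+ 3) ^ (m ℕ.+ 5) ])
    ×
    (2 ∤ b →
    S (k ℕ.* φ (3 ℕ.^ m) ℕ.+ b) - (+ 1 - (- + 3) ^ b) * S b
    ≡ (+ 3) ^ (m ∸ 2) * + k *
    (+ 1422 + + 1242 * + b - + 891 * (+ b) ^ 2 - + 81 * (+ b) ^ 3
    + + 243 * (+ b) ^ 4 + + 729 * (+ b) ^ 5)
    [mod (+ 3) ^ (m ℕ.+ 5) ])
theorem5p1 k m b 1≤k 5≤m =
  -- The omitted Q is solved as `evenPoly (+ b)` or `oddPoly (+ b)`, which unfolds to the stated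
  -- quintic.
  (λ 2∣b → S-congruence k m b 1≤k 5≤m _ {243} refl (μ-even b 2∣b)) ,
  (λ 2∤b → S-congruence k m b 1≤k 5≤m _ {243} refl (μ-odd (2∤⇒odd b 2∤b)))
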